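{- Assume $V=L$. Let $\theta\in\Xi$, $X\in\mathrm{IPS}_\theta$, and let $F:D^\theta\to\mathcal N$ be continuous. Then there is $Y\in\mathrm{IPS}_\theta$ with $Y\subseteq X$ such that one of the following holds: (i) for every $i\in\theta$, $F(y)\notin Y{\Downarrow}i$ for all $y\in Y$; (ii) there is $j\in\theta$ such that $F(y)=y(j)$ for all $y\in Y$, and for every $i\in\theta$ with $i\neq j$, $F(y)\notin Y{\Downarrow}i$ for all $y\in Y$.
   Context: $\mathcal N=\omega^\omega$ is the Baire space, $D=2^\omega\subseteq\mathcal N$ the Cantor space. $T$ is the set of all nonempty finite sequences of countable ordinals, ordered by strict extension $\subset$. $\Xi$ is the set of all at most countable $\xi\subseteq T$ closed downward under $\subset$. $D^\xi$ is the product of $\xi$ copies of $D$ with the product topology; for $\eta\subseteq\xi$ and $x\in D^\xi$, $x\restriction\eta$ is the restriction. For $\zeta\in\Xi$, $\mathrm{IPS}_\zeta$ is the set of all $X\subseteq D^\zeta$ for which there is a homeomorphism $H$ of $D^\zeta$ onto $X$ such that for all $x_0,x_1\in D^\zeta$ and all $\xi\in\Xi$, $\xi\subseteq\zeta$: $x_0\restriction\xi=x_1\restriction\xi\iff H(x_0)\restriction\xi=H(x_1)\restriction\xi$. For $Y\subseteq D^\theta$ and $i\in\theta$, $Y{\Downarrow}i=\{y(i):y\in Y\}$. -}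

module Defs where

open import Level using (Level; 0ℓ; _⊔_) renaming (suc to lsuc)
open import Data.Empty using (⊥)
open import Data.Fin.Base using (Fin; toℕ)
open import Data.List.Base using (List; []; _++_)
import Data.List.Relation.Binary.Pointwise as Pointwise
open import Data.List.NonEmpty.Base using (List⁺; toList; _⁺++⁺_)
open import Data.List.Relation.Unary.All using (All; [])
open import Data.List.Relation.Unary.All.Properties using (++⁺; ++⁻ˡ; ++⁻ʳ)
import Data.List.Relation.Unary.All as All
open import Data.Nat.Base using (ℕ; suc)
open import Data.Product.Base using (Σ; Σ-syntax; ∃; ∃-syntax; _×_; _,_; proj₁; proj₂)
open import Data.Unit.Polymorphic.Base using (⊤; tt)
open import Data.Vec.Functional using () renaming (_∷_ to _◂_)
open import Function.Base using (_∘_)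
open import Function.Bundles using (Func; Injection; Inverse; _⇔_)
open import Relation.Binary.Bundles using (Setoid)
import Relation.Binary.Construct.On as On
open import Relation.Binary.Definitions using (_Respects_)
open import Relation.Binary.PropositionalEquality as ≡ using (_≡_)
open import Relation.Nullary.Negation using (¬_)
open import Relation.Unary using (Pred; _∈_; _⊆_; _≐_; _∩_; ⋃)

private
  1ℓ 2ℓ : Level
  1ℓ = lsuc 0ℓ
  2ℓ = lsuc 1ℓ

-- Aczel's cumulative hierarchy over the universe Set, with bisimilarity as
-- equality of sets.
data 𝕍 : Set₁ where
  sup : (A : Set) → (A → 𝕍) → 𝕍

Index : 𝕍 → Set
Index (sup A _) = A

elem : (x : 𝕍) → Index x → 𝕍
elem (sup _ f) = f

infix 4 _≈ᵥ_ _∈ᵥ_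

_≈ᵥ_ : 𝕍 → 𝕍 → Set
sup A f ≈ᵥ sup B g =
  (∀ a → ∃[ b ] f a ≈ᵥ g b) × (∀ b → ∃[ a ] f a ≈ᵥ g b)

_∈ᵥ_ : 𝕍 → 𝕍 → Set
x ∈ᵥ y = ∃[ b ] x ≈ᵥ elem y b

≈ᵥ-refl : ∀ {x} → x ≈ᵥ x
≈ᵥ-refl {sup A f} = (λ a → a , ≈ᵥ-refl) , (λ a → a , ≈ᵥ-refl)

≈ᵥ-sym : ∀ {x y} → x ≈ᵥ y → y ≈ᵥ x
≈ᵥ-sym {sup A f} {sup B g} (p , q) =
  (λ b → let a , e = q b in a , ≈ᵥ-sym e) ,
  (λ a → let b , e = p a in b , ≈ᵥ-sym e)

≈ᵥ-trans : ∀ {x y z} → x ≈ᵥ y → y ≈ᵥ z → x ≈ᵥ z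
≈ᵥ-trans {sup A f} {sup B g} {sup C h} (p , q) (r , s) =
  (λ a → let b , e = p a ; c , e′ = r b in c , ≈ᵥ-trans e e′) ,
  (λ c → let b , e′ = s c ; a , e = q b in a , ≈ᵥ-trans e e′)

𝕍-setoid : Setoid 1ℓ 0ℓ
𝕍-setoid = record
  { Carrier       = 𝕍
  ; _≈_           = _≈ᵥ_
  ; isEquivalence = record { refl = ≈ᵥ-refl ; sym = ≈ᵥ-sym ; trans = ≈ᵥ-trans }
  }

Transitive : 𝕍 → Set₁
Transitive x = ∀ y z → y ∈ᵥ x → z ∈ᵥ y → z ∈ᵥ x

Ordinal : 𝕍 → Set₁
Ordinal α = Transitive α × (∀ β → β ∈ᵥ α → Transitive β)

-- First-order formulas of the language {∈, =} with free variables in Fin n.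
data Formula (n : ℕ) : Set where
  _∈′_ _=′_ : Fin n → Fin n → Formula n
  ⊥′        : Formula n
  _⇒′_      : Formula n → Formula n → Formula n
  ∀′        : Formula (suc n) → Formula n

-- Satisfaction in the ∈-structure with universe {f a : a ∈ A}; its elements
-- are referred to by their indices, and variable zero is the one bound by ∀′.
Sat : ∀ {A : Set} (f : A → 𝕍) {n} → Formula n → (Fin n → A) → Set
Sat f (i ∈′ j) ρ = f (ρ i) ∈ᵥ f (ρ j)
Sat f (i =′ j) ρ = f (ρ i) ≈ᵥ f (ρ j)
Sat f ⊥′       ρ = ⊥
Sat f (φ ⇒′ ψ) ρ = Sat f φ ρ → Sat f ψ ρ
Sat f (∀′ φ)   ρ = ∀ a → Sat f φ (a ◂ ρ)

-- The set of all subsets of x first-order definable over (x, ∈) with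
-- parameters from x.
Def : 𝕍 → 𝕍
Def (sup A f) = sup (Σ[ n ∈ ℕ ] Formula (suc n) × (Fin n → A))
  λ (n , φ , ρ) → sup (Σ[ a ∈ A ] Sat f φ (a ◂ ρ)) (f ∘ proj₁)

-- L α = ⋃ { Def (L β) : β ∈ α }.  For ordinals α this is the usual hierarchy
-- L 0 = ∅, L (β + 1) = Def (L β), with unions at limits.
L : 𝕍 → 𝕍
L (sup A f) = sup (Σ[ a ∈ A ] Index (Def (L (f a))))
  λ (a , i) → elem (Def (L (f a))) i

V=L : Set₁
V=L = ∀ x → ∃[ α ] Ordinal α × x ∈ᵥ L α

∣_∣ : ∀ {c ℓ} → Setoid c ℓ → Set c
∣ S ∣ = Setoid.Carrier S

⟦_⟧ : ∀ {c ℓ p} {S : Setoid c ℓ} → Pred ∣ S ∣ p → Setoid (c ⊔ p) ℓ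
⟦_⟧ {S = S} P = On.setoid {B = Σ ∣ S ∣ P} S proj₁

AtMostCountable : ∀ {c ℓ} → Setoid c ℓ → Set (c ⊔ ℓ)
AtMostCountable S = Injection S (≡.setoid ℕ)

CountableOrdinal : 𝕍 → Set₁
CountableOrdinal α = Ordinal α × AtMostCountable (⟦_⟧ {S = 𝕍-setoid} (_∈ᵥ α))

Ω₁ : Setoid 1ℓ 0ℓ
Ω₁ = ⟦_⟧ {S = 𝕍-setoid} CountableOrdinal

T : Setoid 1ℓ 1ℓ
T = On.setoid {B = List⁺ ∣ Ω₁ ∣} (Pointwise.setoid Ω₁) toList

module T = Setoid T

-- Strict extension: t is s followed by a nonempty sequence.
infix 4 _⊂_

_⊂_ : ∣ T ∣ → ∣ T ∣ → Set₁
s ⊂ t = ∃[ u ] t T.≈ (s ⁺++⁺ u)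

record Ξ : Set₂ where
  field
    mem       : Pred ∣ T ∣ 1ℓ
    respects  : mem Respects T._≈_
    countable : AtMostCountable (⟦_⟧ {S = T} mem)
    closed    : ∀ {s t} → s ⊂ t → t ∈ mem → s ∈ mem

  setoid : Setoid 1ℓ 1ℓ
  setoid = ⟦_⟧ {S = T} mem

  open Setoid setoid public using (_≈_)

infix 4 _⊑_

_⊑_ : Ξ → Ξ → Set₁
ξ ⊑ ζ = Ξ.mem ξ ⊆ Ξ.mem ζ

-- Subsets are Set₁-valued predicates, hence open-⋃ takes families indexed by
-- types in Set₁; under excluded middle the bound on the level is no restriction
-- on which subsets are considered.
record Space (c ℓ o : Level) : Set (lsuc (c ⊔ ℓ ⊔ o) ⊔ 2ℓ) where
  field
    setoid : Setoid c ℓ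
    Open   : Pred (Pred ∣ setoid ∣ 1ℓ) o

  open Setoid setoid public using (Carrier; _≈_)

  field
    open-resp-≈ : ∀ {O} → Open O → O Respects _≈_
    open-resp-≐ : ∀ {O P} → O ≐ P → Open O → Open P
    open-U      : Open (λ _ → ⊤)
    open-∩      : ∀ {O P} → Open O → Open P → Open (O ∩ P)
    open-⋃      : ∀ {I : Set₁} {O : I → Pred Carrier 1ℓ} →
                  (∀ i → Open (O i)) → Open (⋃ I O)

discrete : Set → Space 0ℓ 0ℓ 0ℓ
discrete A = record
  { setoid      = ≡.setoid A
  ; Open        = λ _ → ⊤
  ; open-resp-≈ = λ { _ ≡.refl o → o }
  }

infixr 0 _⟶_

_⟶_ : ∀ {a b c d} → Setoid a b → Setoid c d → Set (a ⊔ b ⊔ c ⊔ d)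
_⟶_ = Func

functions : ∀ {a b c d} → Setoid a b → Setoid c d → Setoid (a ⊔ b ⊔ c ⊔ d) (a ⊔ d)
functions I S = record
  { Carrier       = I ⟶ S
  ; _≈_           = λ x y → ∀ i → Func.to x i S.≈ Func.to y i
  ; isEquivalence = record
    { refl  = λ _ → S.refl
    ; sym   = λ e i → S.sym (e i)
    ; trans = λ e e′ i → S.trans (e i) (e′ i)
    }
  }
  where module S = Setoid S

module _ {a b c ℓ o} (S : Space c ℓ o) (I : Setoid a b) where
  private module S = Space S

  -- The list (i₁ , O₁) ∷ … ∷ (iₖ , Oₖ) ∷ [] codes the basic open set
  -- { x : x(i₁) ∈ O₁ , … , x(iₖ) ∈ Oₖ }.
  BoxCode : Set (a ⊔ c ⊔ o ⊔ 2ℓ)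
  BoxCode = List (∣ I ∣ × ∃ S.Open)

  Box : BoxCode → Pred (I ⟶ S.setoid) (a ⊔ c ⊔ o ⊔ 2ℓ)
  Box B x = All (λ (i , O , _) → Func.to x i ∈ O) B

  -- Open sets are those containing, around each point, a basic open box.
  power : Space (a ⊔ b ⊔ c ⊔ ℓ) (a ⊔ ℓ) (a ⊔ b ⊔ c ⊔ ℓ ⊔ o ⊔ 2ℓ)
  power = record
    { setoid      = functions I S.setoid
    ; Open        = λ O → ∀ x → x ∈ O → ∃[ B ] x ∈ Box B × Box B ⊆ O
    ; open-resp-≈ = λ o {x} x≈y x∈O →
        let B , x∈B , B⊆O = o x x∈O
        in B⊆O (All.map (λ { {i , _ , oᵢ} → S.open-resp-≈ oᵢ (x≈y i) }) x∈B)
    ; open-resp-≐ = λ (O⊆P , P⊆O) o x x∈P →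
        let B , x∈B , B⊆O = o x (P⊆O x∈P)
        in B , x∈B , λ y∈B → O⊆P (B⊆O y∈B)
    ; open-U      = λ _ _ → [] , [] , _
    ; open-∩      = λ o p x (x∈O , x∈P) →
        let B , x∈B , B⊆O = o x x∈O
            C , x∈C , C⊆P = p x x∈P
        in B ++ C , ++⁺ x∈B x∈C ,
           λ y∈BC → B⊆O (++⁻ˡ B y∈BC) , C⊆P (++⁻ʳ B y∈BC)
    ; open-⋃      = λ o x (i , x∈Oᵢ) →
        let B , x∈B , B⊆Oᵢ = o i x x∈Oᵢ
        in B , x∈B , λ y∈B → i , B⊆Oᵢ y∈B
    }

subspace : ∀ {c ℓ o} (S : Space c ℓ o) → Pred (Space.Carrier S) 1ℓ →
           Space (c ⊔ 1ℓ) ℓ (c ⊔ o ⊔ 2ℓ)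
subspace S X = record
  { setoid      = ⟦_⟧ {S = S.setoid} X
  ; Open        = λ O → ∃[ W ] S.Open W × Trace W O
  ; open-resp-≈ = λ (W , w , to , from) e x∈O → from (S.open-resp-≈ w e (to x∈O))
  ; open-resp-≐ = λ (O⊆P , P⊆O) (W , w , to , from) →
      W , w , (λ x∈P → to (P⊆O x∈P)) , (λ x∈W → O⊆P (from x∈W))
  ; open-U      = _ , S.open-U , (λ _ → tt) , (λ _ → tt)
  ; open-∩      = λ (W , w , to , from) (W′ , w′ , to′ , from′) →
      W ∩ W′ , S.open-∩ w w′ ,
      (λ (p , q) → to p , to′ q) , (λ (p , q) → from p , from′ q)
  ; open-⋃      = λ o →
      _ , S.open-⋃ (λ i → proj₁ (proj₂ (o i))) ,
      (λ (i , p) → i , proj₁ (proj₂ (proj₂ (o i))) p) ,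
      (λ (i , p) → i , proj₂ (proj₂ (proj₂ (o i))) p)
  }
  where
  module S = Space S
  Trace : Pred S.Carrier 1ℓ → Pred (Σ S.Carrier X) 1ℓ → Set _
  Trace W O = O ≐ (W ∘ proj₁)

Continuous : ∀ {a b o c d p} (A : Space a b o) (B : Space c d p) →
             (Space.Carrier A → Space.Carrier B) → Set _
Continuous A B f = ∀ O → Space.Open B O → Space.Open A (O ∘ f)

record Homeomorphism {a b o c d p} (A : Space a b o) (B : Space c d p) :
                     Set (a ⊔ b ⊔ o ⊔ c ⊔ d ⊔ p ⊔ 2ℓ) where
  field
    inverse : Inverse (Space.setoid A) (Space.setoid B)

  open Inverse inverse public using (to; from)

  field
    to-continuous   : Continuous A B to
    from-continuous : Continuous B A from

𝒩 D : Space 0ℓ 0ℓ 2ℓ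
𝒩 = power (discrete ℕ) (≡.setoid ℕ)
D = power (discrete (Fin 2)) (≡.setoid ℕ)

-- The inclusion 2^ω ⊆ ω^ω.
ι : Space.Carrier D → Space.Carrier 𝒩
ι x = record
  { to   = λ n → toℕ (Func.to x n)
  ; cong = λ e → ≡.cong toℕ (Func.cong x e)
  }

D^ : Ξ → Space 1ℓ 1ℓ 2ℓ
D^ ξ = power D (Ξ.setoid ξ)

Point : Ξ → Set₁
Point ξ = Space.Carrier (D^ ξ)

_[_] : ∀ {a b} {I : Setoid a b} → (I ⟶ Space.setoid D) → ∣ I ∣ → Space.Carrier D
x [ i ] = Func.to x i

restrict : ∀ {ξ ζ} → ξ ⊑ ζ → Point ζ → Point ξ
restrict ξ⊑ζ x = record
  { to   = λ (i , i∈ξ) → x [ i , ξ⊑ζ i∈ξ ]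
  ; cong = λ e → Func.cong x e
  }

PreservesProjections : ∀ {ζ} {X : Pred (Point ζ) 1ℓ} → (Point ζ → Σ (Point ζ) X) → Set₂
PreservesProjections {ζ} H = ∀ (ξ : Ξ) (ξ⊑ζ : ξ ⊑ ζ) x₀ x₁ →
  let open Space (D^ ξ) using (_≈_)
      _↾ξ = restrict {ξ} {ζ} ξ⊑ζ
  in (x₀ ↾ξ) ≈ (x₁ ↾ξ) ⇔ (proj₁ (H x₀) ↾ξ) ≈ (proj₁ (H x₁) ↾ξ)

record IPS (ζ : Ξ) (X : Pred (Point ζ) 1ℓ) : Set₂ where
  field
    respects      : X Respects Space._≈_ (D^ ζ)
    homeomorphism : Homeomorphism (D^ ζ) (subspace (D^ ζ) X)
    preserves     : PreservesProjections {ζ} {X} (Homeomorphism.to homeomorphism)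

-- Y ⇓ i = { y(i) : y ∈ Y }, as a subset of 𝒩 via D ⊆ 𝒩.
_⇓_ : ∀ {a b p} {I : Setoid a b} → Pred (I ⟶ Space.setoid D) p → ∣ I ∣ →
      Pred (Space.Carrier 𝒩) (a ⊔ b ⊔ p)
(Y ⇓ i) z = ∃[ y ] y ∈ Y × z ≈ ι (y [ i ])
  where open Space 𝒩 using (_≈_)

{-# OPTIONS --safe #-}
module Submission where

-- Enumerating θ turns points of D^θ into functions x : ℕ → ℕ → {0,1} and the tree
-- order on θ into a partial order ≼ on ℕ.  Write X = H[D^θ] with H projection-preserving,
-- h_i(x) = H(x)(i) and G = F ∘ H.  Either G ∘ K = h_j ∘ K for some projection-preserving
-- embedding K of D^θ into itself and some j, or not.  In the second case a fusion produces
-- an embedding K with G(K x) ≠ h_i(K y) for all x, y, i.  At stage m one treats every pair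
-- u, v of m-bit approximations and must separate G on [u] from h_i on [v] by shrinking both
-- sides compatibly, i.e. keeping equal what u and v share along initial segments of ≼.
-- If that were impossible then G(x) = h_i(y) for all compatible x ∈ [u], y ∈ [v]; when u, v
-- agree below i this gives G = h_i on [u], and otherwise y(i) can be varied with x fixed,
-- contradicting that h_i is injective in the i-th coordinate.  In the first case the
-- same fusion is applied to G = h_j against all h_i with i ≠ j.

open import Defs
open import Axiom.ExcludedMiddle using (ExcludedMiddle)
open import Data.Empty using (⊥)
open import Data.Fin.Base using (Fin; zero; suc; toℕ)
open import Data.Fin.Properties using (toℕ-injective)
open import Data.List.Base using (List; []; _∷_; _++_; concatMap; cartesianProduct; upTo; length)
open import Data.List.Membership.Propositional using () renaming (_∈_ to _∈ₗ_)
open import Data.List.Membership.Propositional.Properties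
  using (∈-cartesianProduct⁺; ∈-upTo⁺; ∈-concatMap⁺)
open import Data.List.NonEmpty.Base using (toList; _⁺++⁺_)
open import Data.List.Properties using (length-++; ++-assoc)
import Data.List.Relation.Binary.Pointwise as Pointwise
open import Data.List.Relation.Unary.All using ([]; _∷_)
open import Data.List.Relation.Unary.Any using (here; there)
import Data.List.Relation.Unary.Any as Any
open import Data.Nat.Base using (ℕ; zero; suc; _+_; _∸_; _⊔_; _≤_; _<_; z≤n; s≤s)
open import Data.Nat.Properties
open import Data.Product.Base using (Σ-syntax; ∃-syntax; _×_; _,_; proj₁; proj₂)
open import Data.Sum.Base using (_⊎_; inj₁; inj₂)
open import Data.Unit.Polymorphic.Base using (tt)
open import Function.Base using (id; _∘_)
open import Function.Bundles using (Func; Injection; Inverse; Equivalence; mk⇔; _⇔_)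
open import Level using (Lift; lift; 0ℓ) renaming (suc to lsuc)
open import Relation.Binary.Bundles using (Setoid)
open import Relation.Binary.Core using (Rel)
open import Relation.Binary.Definitions using (Reflexive; Antisymmetric)
  renaming (Transitive to IsTransitive)
open import Relation.Binary.PropositionalEquality as ≡
  using (_≡_; _≢_; refl; sym; trans; cong; subst)
open import Relation.Nullary.Decidable using (Dec; yes; no; decidable-stable)
open import Relation.Nullary.Negation using (¬_; contradiction)
open import Relation.Unary using (Pred; _∈_; _∉_; _⊆_)

-- Points as bit matrices, square approximations and finite nets

Pt : Set
Pt = ℕ → ℕ → Fin 2

infix 4 _~[_]_

_~[_]_ : Pt → ℕ → Pt → Set
x ~[ m ] y = ∀ k n → k < m → n < m → x k n ≡ y k n

~-refl : ∀ {m x} → x ~[ m ] x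
~-refl k n _ _ = refl

~-sym : ∀ {m x y} → x ~[ m ] y → y ~[ m ] x
~-sym p k n k< n< = sym (p k n k< n<)

~-trans : ∀ {m x y z} → x ~[ m ] y → y ~[ m ] z → x ~[ m ] z
~-trans p q k n k< n< = trans (p k n k< n<) (q k n k< n<)

~-anti : ∀ {m m′ x y} → m ≤ m′ → x ~[ m′ ] y → x ~[ m ] y
~-anti m≤ p k n k< n< = p k n (<-≤-trans k< m≤) (<-≤-trans n< m≤)

set : Pt → ℕ → ℕ → Fin 2 → Pt
set x i m b k n with k ≟ i | n ≟ m
... | yes _ | yes _ = b
... | yes _ | no _  = x k n
... | no _  | _     = x k n

set-hit : ∀ x i m b → set x i m b i m ≡ b
set-hit x i m b with i ≟ i | m ≟ m
... | yes _ | yes _ = refl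
... | yes _ | no ne = contradiction refl ne
... | no ne | _     = contradiction refl ne

set-other-coord : ∀ x i m b k n → k ≢ i → set x i m b k n ≡ x k n
set-other-coord x i m b k n ne with k ≟ i | n ≟ m
... | yes p | _ = contradiction p ne
... | no _  | _ = refl

set-other-bit : ∀ x i m b k n → n ≢ m → set x i m b k n ≡ x k n
set-other-bit x i m b k n ne with k ≟ i | n ≟ m
... | yes _ | yes p = contradiction p ne
... | yes _ | no _  = refl
... | no _  | _     = refl

set-agree : ∀ (x y : Pt) i m b k n → x k n ≡ y k n → x i m ≡ b → x k n ≡ set y i m b k n
set-agree x y i m b k n eq eqb with k ≟ i | n ≟ m
... | yes refl | yes refl = eqb
... | yes _ | no _  = eq
... | no _  | _     = eq

flip : Fin 2 → Fin 2
flip zero       = suc zero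
flip (suc zero) = zero

flip-≢ : ∀ b → b ≢ flip b
flip-≢ zero       ()
flip-≢ (suc zero) ()

setBoth : ℕ × ℕ → Pt → List Pt
setBoth (k , n) u = set u k n zero ∷ set u k n (suc zero) ∷ []

∈-setBoth : ∀ k n u b → set u k n b ∈ₗ setBoth (k , n) u
∈-setBoth k n u zero       = here refl
∈-setBoth k n u (suc zero) = there (here refl)

representatives : ∀ (ps : List (ℕ × ℕ)) → ∃[ us ] ∀ (z : Pt) →
  ∃[ u ] u ∈ₗ us × (∀ k n → (k , n) ∈ₗ ps → z k n ≡ u k n)
representatives [] = (λ _ _ → zero) ∷ [] , λ z → _ , here refl , λ _ _ ()
representatives ((k , n) ∷ ps) =
  let us , cover = representatives ps in
  concatMap (setBoth (k , n)) us , λ z →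
  let u , u∈us , eq = cover z in
  set u k n (z k n) ,
  ∈-concatMap⁺ (setBoth (k , n))
    (Any.map (λ { refl → ∈-setBoth k n u (z k n) }) u∈us) ,
  λ { k′ n′ (here refl) → sym (set-hit u k n (z k n))
    ; k′ n′ (there p)   → set-agree z u k n (z k n) k′ n′ (eq k′ n′ p) refl }

-- An `m`-square carries only finitely many bit patterns; this finiteness lets a single stage of the
-- fusion treat all pairs of approximations.
net : ∀ m → ∃[ us ] ∀ z → ∃[ u ] u ∈ₗ us × z ~[ m ] u
net m =
  let us , cover = representatives (cartesianProduct (upTo m) (upTo m)) in
  us , λ z →
  let u , u∈us , eq = cover z in
  u , u∈us , λ k n k< n< → eq k n (∈-cartesianProduct⁺ (∈-upTo⁺ k<) (∈-upTo⁺ n<))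

-- Projection-preserving embeddings and grafting of stems

module Embeddings {ℓ} (em : ∀ {a} → ExcludedMiddle a)
  (_≼_ : Rel ℕ ℓ) (≼-refl : Reflexive _≼_) (≼-trans : IsTransitive _≼_) where

  Agree : ℕ → ℕ → Pt → Pt → Set ℓ
  Agree m l x y = ∀ k n → k ≼ l → k < m → n < m → x k n ≡ y k n

  infix 4 _≈[_]_
  _≈[_]_ : Pt → ℕ → Pt → Set ℓ
  x ≈[ l ] y = ∀ k n → k ≼ l → x k n ≡ y k n

  ~⇒Agree : ∀ {m l x y} → x ~[ m ] y → Agree m l x y
  ~⇒Agree p k n _ = p k n

  Agree⇒~ : ∀ {m x y} → (∀ l → Agree m l x y) → x ~[ m ] y
  Agree⇒~ p k n = p k k n ≼-refl

  Agree-sym : ∀ {m l x y} → Agree m l x y → Agree m l y x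
  Agree-sym p k n k≼ k< n< = sym (p k n k≼ k< n<)

  Agree-trans : ∀ {m l x y z} → Agree m l x y → Agree m l y z → Agree m l x z
  Agree-trans p q k n k≼ k< n< = trans (p k n k≼ k< n<) (q k n k≼ k< n<)

  Agree-anti : ∀ {m m′ l l′ x y} → m ≤ m′ → l ≼ l′ → Agree m′ l′ x y → Agree m l x y
  Agree-anti m≤ l≼ p k n k≼ k< n< =
    p k n (≼-trans k≼ l≼) (<-≤-trans k< m≤) (<-≤-trans n< m≤)

  -- A quantitative form of projection-preserving embedding. The identity is a modulus of continuity
  -- relative to every initial segment, which survives limits; the modulus of the inverse is uniform
  -- in `l`. Letting `m` grow gives preservation of projections in both directions.
  record Embedding (K : Pt → Pt) : Set ℓ where
    field
      lipschitz : ∀ {m l x y} → Agree m l x y → Agree m l (K x) (K y)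
      inverse   : ∀ m → ∃[ N ] ∀ {l x y} → Agree N l (K x) (K y) → Agree m l x y

    lipschitz-~ : ∀ {m x y} → x ~[ m ] y → K x ~[ m ] K y
    lipschitz-~ p = Agree⇒~ (λ l → lipschitz (~⇒Agree p))

    lipschitz-≈ : ∀ {l x y} → x ≈[ l ] y → K x ≈[ l ] K y
    lipschitz-≈ p k n k≼l =
      lipschitz {m = suc (k ⊔ n)} (λ k′ n′ k′≼l _ _ → p k′ n′ k′≼l) k n k≼l
        (s≤s (m≤m⊔n k n)) (s≤s (m≤n⊔m k n))

    inverse-≈ : ∀ {l x y} → K x ≈[ l ] K y → x ≈[ l ] y
    inverse-≈ p k n k≼l =
      proj₂ (inverse (suc (k ⊔ n))) (λ k′ n′ k′≼l _ _ → p k′ n′ k′≼l) k n k≼l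
        (s≤s (m≤m⊔n k n)) (s≤s (m≤n⊔m k n))

  id-embedding : Embedding id
  id-embedding = record { lipschitz = id ; inverse = λ m → m , id }

  ∘-embedding : ∀ {K J} → Embedding K → Embedding J → Embedding (K ∘ J)
  ∘-embedding κ ι′ = record
    { lipschitz = λ p → Embedding.lipschitz κ (Embedding.lipschitz ι′ p)
    ; inverse   = λ m →
        let N , f = Embedding.inverse ι′ m ; N′ , g = Embedding.inverse κ N
        in N′ , λ p → f (g p)
    }

  -- The tail after the stem is all of z l, not z l from bit m on: repeating the first
  -- m bits is harmless and makes the shift the same for coordinates below and above m.
  graft : ℕ → Pt → ℕ → Pt → Pt → Pt
  graft m u N x z l n with em {P = Agree m l z u}
  ... | no _ = z l n
  ... | yes _ with n <? N
  ...   | yes _ = x l n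
  ...   | no _  = z l (n ∸ N)

  module _ {m : ℕ} {u : Pt} {N : ℕ} {x : Pt} where

    graft-stem : ∀ z l n → Agree m l z u → n < N → graft m u N x z l n ≡ x l n
    graft-stem z l n a n< with em {P = Agree m l z u}
    ... | no ¬a = contradiction a ¬a
    ... | yes _ with n <? N
    ...   | yes _ = refl
    ...   | no n≮ = contradiction n< n≮

    graft-tail : ∀ z l n → Agree m l z u → ¬ n < N → graft m u N x z l n ≡ z l (n ∸ N)
    graft-tail z l n a n≮ with em {P = Agree m l z u}
    ... | no ¬a = contradiction a ¬a
    ... | yes _ with n <? N
    ...   | yes n< = contradiction n< n≮
    ...   | no _ = refl

    graft-off : ∀ z l n → ¬ Agree m l z u → graft m u N x z l n ≡ z l n
    graft-off z l n ¬a with em {P = Agree m l z u}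
    ... | no _ = refl
    ... | yes a = contradiction a ¬a

    graft-near : ∀ {z} → z ~[ m ] u → graft m u N x z ~[ N ] x
    graft-near p l n _ n< = graft-stem _ l n (~⇒Agree p) n<

    module _ (m≤N : m ≤ N) (x~u : x ~[ m ] u) where

      -- Where the graft acts, `z` and `x` both carry the bits of `u` in the `m`-square, and `m ≤ N`
      -- puts that square inside the stem; elsewhere `z` is untouched.
      graft-~ : ∀ z → graft m u N x z ~[ m ] z
      graft-~ z k n k< n< with em {P = Agree m k z u}
      ... | no _ = refl
      ... | yes a with n <? N
      ...   | yes _ = trans (x~u k n k< n<) (sym (a k n ≼-refl k< n<))
      ...   | no n≮ = contradiction (<-≤-trans n< m≤N) n≮

      -- Since the `m`-square is unchanged, the image reveals at which coordinates the graft acted,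
      -- and there `z` is recovered by undoing the shift by `N`. So the inverse needs `m` for the
      -- decision and `N + m′` for the shifted bits.
      graft-embedding : Embedding (graft m u N x)
      graft-embedding = record { lipschitz = lip ; inverse = λ m′ → m ⊔ (N + m′) , inv m′ }
        where
        g = graft m u N x

        lip : ∀ {m′ l z z′} → Agree m′ l z z′ → Agree m′ l (g z) (g z′)
        -- For `m′` below `m` the agreement is too short to decide whether both points are grafted,
        -- but then the `m′`-square does not change at all. From `m` on, both are grafted at `k` or
        -- neither is.
        lip {m′} {l} {z} {z′} p k n k≼ k< n< with ≤-total m′ m
        ... | inj₁ m′≤m = trans (~-anti m′≤m (graft-~ z) k n k< n<)
                            (trans (p k n k≼ k< n<)
                              (sym (~-anti m′≤m (graft-~ z′) k n k< n<)))
        ... | inj₂ m≤m′ with em {P = Agree m k z u}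
        ...   | no ¬a = trans (p k n k≼ k< n<)
                          (sym (graft-off z′ k n λ a → ¬a (Agree-trans (Agree-anti m≤m′ k≼ p) a)))
        ...   | yes a with n <? N
        ...     | yes n<N = sym (graft-stem z′ k n
                              (Agree-trans (Agree-sym (Agree-anti m≤m′ k≼ p)) a) n<N)
        ...     | no n≮N  = trans (p k (n ∸ N) k≼ k< (≤-<-trans (m∸n≤m n N) n<))
                              (sym (graft-tail z′ k n
                                (Agree-trans (Agree-sym (Agree-anti m≤m′ k≼ p)) a) n≮N))

        tail : ∀ z k n → Agree m k z u → g z k (N + n) ≡ z k n
        tail z k n a = trans (graft-tail z k (N + n) a (≤⇒≯ (m≤m+n N n)))
                             (cong (z k) (m+n∸m≡n N n))

        inv : ∀ m′ {l z z′} → Agree (m ⊔ (N + m′)) l (g z) (g z′) → Agree m′ l z z′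
        inv m′ {l} {z} {z′} p k n k≼ k< n< = go (em {P = Agree m k z u})
          where
          M = m ⊔ (N + m′)
          small : ∀ {a} → a < N + m′ → a < M
          small a< = <-≤-trans a< (m≤n⊔m m (N + m′))
          k<M : k < M
          k<M = small (<-≤-trans k< (m≤n+m m′ N))
          z~z′ : Agree m k z z′
          z~z′ = Agree-trans (~⇒Agree (~-sym (graft-~ z)))
                   (Agree-trans (Agree-anti (m≤m⊔n m (N + m′)) k≼ p) (~⇒Agree (graft-~ z′)))
          go : Dec (Agree m k z u) → z k n ≡ z′ k n
          go (yes a) = trans (sym (tail z k n a))
            (trans (p k (N + n) k≼ k<M (small (+-monoʳ-< N n<)))
              (tail z′ k n (Agree-trans (Agree-sym z~z′) a)))
          go (no ¬a) = trans (sym (graft-off z k n ¬a))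
            (trans (p k n k≼ k<M (small (<-≤-trans n< (m≤n+m m′ N))))
              (graft-off z′ k n λ a → ¬a (Agree-trans z~z′ a)))

  module _ (≼-antisym : Antisymmetric _≡_ _≼_) {h : Pt → Pt}
    (h-lower : ∀ {l x y} → x ≈[ l ] y → h x ≈[ l ] h y)
    (h-lower⁻¹ : ∀ {l x y} → h x ≈[ l ] h y → x ≈[ l ] y) where

    -- x and y agree strictly below i, so equality of h x and h y at i would
    -- make h x and h y, and hence x and y, agree up to and including i.
    coordinate-injective : ∀ i m x y → (∀ k n → k ≢ i → x k n ≡ y k n) →
      x i m ≢ y i m → ¬ (∀ n → h x i n ≡ h y i n)
    coordinate-injective i m x y off ne eq = ne (h-lower⁻¹ {i} below i m ≼-refl)
      where
      below : h x ≈[ i ] h y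
      below k n k≼i with k ≟ i
      ... | yes refl = eq n
      ... | no k≢i = h-lower {k}
        (λ k′ n′ k′≼k → off k′ n′ λ { refl → k≢i (≼-antisym k≼i k′≼k) })
        k n ≼-refl

  -- Flip one bit of `z` at `j`. Coordinate `i` of `f z` does not depend on it, because `j` is not
  -- below `i`, whereas coordinate `j` must change.
  distinct-coordinates : ∀ {f : Pt → Pt} → (∀ {l x y} → x ≈[ l ] y → f x ≈[ l ] f y) →
    (∀ {l x y} → f x ≈[ l ] f y → x ≈[ l ] y) → Antisymmetric _≡_ _≼_ →
    ∀ {i j} → ¬ (j ≼ i) → ¬ (∀ z n → f z i n ≡ f z j n)
  distinct-coordinates lower lower⁻¹ antisym {i} {j} j⋠i eq =
    coordinate-injective antisym lower lower⁻¹ j 0 z z′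
      (λ k n ne → sym (set-other-coord z j 0 _ k n ne))
      (λ e → flip-≢ (z j 0) (trans e (set-hit z j 0 _)))
      λ n → trans (sym (eq z n)) (trans (lower below i n ≼-refl) (eq z′ n))
    where
    z z′ : Pt
    z = λ _ _ → zero
    z′ = set z j 0 (flip (z j 0))
    below : z ≈[ i ] z′
    below k n k≼i = sym (set-other-coord z j 0 _ k n λ { refl → j⋠i k≼i })

  -- Separating a continuous function from a coordinate

  module Separation (≼-antisym : Antisymmetric _≡_ _≼_)
    (G : Pt → ℕ → ℕ) (h : Pt → Pt)
    (G-continuous : ∀ x n → ∃[ N ] ∀ y → y ~[ N ] x → G y n ≡ G x n)
    (h-continuous : ∀ x k n → ∃[ N ] ∀ y → y ~[ N ] x → h y k n ≡ h x k n)
    (h-lower : ∀ {l x y} → x ≈[ l ] y → h x ≈[ l ] h y)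
    (h-lower⁻¹ : ∀ {l x y} → h x ≈[ l ] h y → x ≈[ l ] y) where

    Equal : ℕ → Pt → Pt → Set
    Equal i x y = ∀ n → G x n ≡ toℕ (h y i n)

    -- Quantifying over all embeddings makes the property hereditary: it applies to the composite
    -- with whatever has been built so far. Only diagonal coincidences are excluded; pairs of
    -- different points are handled in `compatible-unequal`.
    Avoidable : ℕ → Set ℓ
    Avoidable i = ∀ {K} → Embedding K → ¬ (∀ z → Equal i (K z) (K z))

    -- Speaks of whole cylinders, so that it persists when later stages move the two points within
    -- them.
    Separated : ℕ → ℕ → Pt → Pt → Set
    Separated i N x y = ∀ x′ y′ → x′ ~[ N ] x → y′ ~[ N ] y → ¬ Equal i x′ y′

    Separated-resp : ∀ {i N M x x′ y y′} → N ≤ M → x′ ~[ N ] x → y′ ~[ N ] y →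
      Separated i N x y → Separated i M x′ y′
    Separated-resp N≤M p q s a b a~ b~ =
      s a b (~-trans (~-anti N≤M a~) p) (~-trans (~-anti N≤M b~) q)

    unequal⇒separated : ∀ i x y n → G x n ≢ toℕ (h y i n) → ∃[ N ] Separated i N x y
    unequal⇒separated i x y n ne =
      let N , f = G-continuous x n ; N′ , g = h-continuous y i n
      in N ⊔ N′ , λ x′ y′ x~ y~ eq → ne
           (trans (sym (f x′ (~-anti (m≤m⊔n N N′) x~)))
             (trans (eq n) (cong toℕ (g y′ (~-anti (m≤n⊔m N N′) y~)))))

    -- The partner of `x` in the cylinder of `v`: it follows `x` where compatibility forces it to,
    -- and `v` elsewhere.
    glue : ℕ → Pt → Pt → Pt → Pt
    glue m u v x l n with em {P = Agree m l u v}
    ... | yes _ = x l n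
    ... | no _  = v l n

    glue-on : ∀ {m u v x} l n → Agree m l u v → glue m u v x l n ≡ x l n
    glue-on {m} {u} {v} l n a with em {P = Agree m l u v}
    ... | yes _ = refl
    ... | no ¬a = contradiction a ¬a

    glue-~ : ∀ {m u v x} → x ~[ m ] u → glue m u v x ~[ m ] v
    glue-~ {m} {u} {v} p k n k< n< with em {P = Agree m k u v}
    ... | yes a = trans (p k n k< n<) (a k n ≼-refl k< n<)
    ... | no _  = refl

    module _ {K} (κ : Embedding K) {i} (avoidable : Avoidable i) (m : ℕ) (u v : Pt) where
      open Embedding κ

      -- The pairs that can serve as stems over `u` and over `v` at the same time: where a point can
      -- agree with both `u` and `v`, the two stems must coincide.
      Compatible : Pt → Pt → Set ℓ
      Compatible x y = x ~[ m ] u × y ~[ m ] v × (∀ l n → Agree m l u v → x l n ≡ y l n)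

      compatible-unequal : ∃[ x ] ∃[ y ] Compatible x y × ∃[ n ] G (K x) n ≢ toℕ (h (K y) i n)
      compatible-unequal
        with em {P = ∃[ x ] ∃[ y ] Compatible x y × ∃[ n ] G (K x) n ≢ toℕ (h (K y) i n)}
      ... | yes found = found
      ... | no none = contradiction all-equal impossible
        where
        all-equal : ∀ x y → Compatible x y → Equal i (K x) (K y)
        all-equal x y c n = decidable-stable (_ ≟ _) λ ne → none (_ , _ , c , n , ne)

        impossible : ¬ (∀ x y → Compatible x y → Equal i (K x) (K y))
        impossible equal with em {P = Agree m i u v}
        -- With parameter 0 the agreement condition is vacuous, so every point receives the first
        -- `m` bits of `u` at all coordinates: this graft maps everything into the cylinder of `u`.
        ... | yes a = avoidable (∘-embedding κ (graft-embedding {0} {u} z≤n (λ _ _ ())))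
                        λ z n →
                          let x = graft 0 u m u z
                              x~u = graft-near {0} {u} {m} {u} {z} (λ _ _ ())
                              -- As `u` and `v` agree below `i`, the partner of `x` equals `x` up to
                              -- `i`, and `h` at `i` sees no more than that.
                              same : glue m u v x ≈[ i ] x
                              same k n k≼i = glue-on k n (Agree-anti ≤-refl k≼i a)
                          in trans
                               (equal x (glue m u v x)
                                 (x~u , glue-~ x~u , λ l n b → sym (glue-on l n b)) n)
                               (cong toℕ (h-lower (lipschitz-≈ same) i n ≼-refl))
        ... | no ¬a = coordinate-injective ≼-antisym
                        {λ x → h (K x)}
                        (λ p → h-lower (lipschitz-≈ p)) (λ p → inverse-≈ (h-lower⁻¹ p))
                        i m y y′
                        (λ k n ne → sym (set-other-coord y i m _ k n ne))
                        (λ eq → flip-≢ (y i m) (trans eq (set-hit y i m _)))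
                        λ n → toℕ-injective (trans (sym (equal u y c n)) (equal u y′ c′ n))
          where
          y = glue m u v u
          -- Bit `m` lies just outside the `m`-square, so `y′` stays in the cylinder of `v`;
          -- coordinate `i` is free because `u` and `v` disagree below it.
          y′ = set y i m (flip (y i m))
          c : Compatible u y
          c = ~-refl , glue-~ ~-refl , λ l n b → sym (glue-on l n b)
          c′ : Compatible u y′
          c′ = ~-refl ,
               ~-trans (λ k n _ n< → set-other-bit y i m _ k n (<⇒≢ n<)) (glue-~ ~-refl) ,
               λ l n b → trans (sym (glue-on l n b))
                 (sym (set-other-coord y i m _ l n λ { refl → ¬a b }))

      -- Graft `x` over `u`, then `y` over `v`. Points of the second cylinder stay in it under the
      -- first graft and are then sent near `y`; those of the first go near `x` and remain there by
      -- `graft-stays`.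
      separate-pair : ∃[ J ] ∃[ N ] Embedding J × (∀ z → J z ~[ m ] z) ×
        (∀ z z′ → z ~[ m ] u → z′ ~[ m ] v → Separated i N (K (J z)) (K (J z′)))
      separate-pair =
        let x , y , (x~u , y~v , x≡y) , n , ne = compatible-unequal
            N₀ , sep = unequal⇒separated i (K x) (K y) n ne
            -- Length `N₀` is needed for the separation, length `m` for the grafts to fix
            -- `m`-squares.
            N = m ⊔ N₀
            m≤N = m≤m⊔n m N₀
            g₁ = graft m u N x
            g₂ = graft m v N y
            g₁-~ = graft-~ m≤N x~u
            g₂-~ = graft-~ m≤N y~v
        in g₂ ∘ g₁ , N ,
           ∘-embedding (graft-embedding m≤N y~v) (graft-embedding m≤N x~u) ,
           (λ z → ~-trans (g₂-~ (g₁ z)) (g₁-~ z)) ,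
           λ z z′ z~u z′~v → Separated-resp (m≤n⊔m m N₀)
             (lipschitz-~ (~-anti (m≤n⊔m m N₀)
               (graft-stays x≡y (~-trans (g₁-~ z) z~u) (graft-near z~u))))
             (lipschitz-~ (~-anti (m≤n⊔m m N₀)
               (graft-near (~-trans (g₁-~ z′) z′~v))))
             sep
        where
        -- The second graft acts only where `w`, hence `u`, agrees with `v`; there its stem `y`
        -- coincides with `x`.
        graft-stays : ∀ {x y N w} → (∀ l n → Agree m l u v → x l n ≡ y l n) →
          w ~[ m ] u → w ~[ N ] x → graft m v N y w ~[ N ] x
        graft-stays {x} {y} {N} {w} x≡y w~u w~x k n k< n< = go em
          where
          go : Dec (Agree m k w v) → graft m v N y w k n ≡ x k n
          go (yes a) = trans (graft-stem w k n a n<)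
            (sym (x≡y k n (Agree-trans (~⇒Agree (~-sym w~u)) a)))
          go (no ¬a) = trans (graft-off w k n ¬a) (w~x k n k< n<)

    -- Later maps keep every point in its `m`-cylinder, so a pair once separated stays separated.
    separate-pairs : ∀ {K} → Embedding K → ∀ {i} → Avoidable i → ∀ m (ps : List (Pt × Pt)) →
      ∃[ J ] ∃[ N ] Embedding J × (∀ z → J z ~[ m ] z) ×
      (∀ {u v} → (u , v) ∈ₗ ps → ∀ z z′ → z ~[ m ] u → z′ ~[ m ] v →
         Separated i N (K (J z)) (K (J z′)))
    separate-pairs κ avoidable m [] = id , 0 , id-embedding , (λ _ → ~-refl) , λ ()
    separate-pairs κ avoidable m ((u , v) ∷ ps) =
      let J , N , ι₁ , J-~ , sep = separate-pair κ avoidable m u v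
          J′ , N′ , ι₂ , J′-~ , seps = separate-pairs (∘-embedding κ ι₁) avoidable m ps
      in J ∘ J′ , N ⊔ N′ , ∘-embedding ι₁ ι₂ ,
         (λ z → ~-trans (J-~ (J′ z)) (J′-~ z)) ,
         λ { (here refl) z z′ p q → Separated-resp (m≤m⊔n N N′) ~-refl ~-refl
               (sep (J′ z) (J′ z′) (~-trans (J′-~ z) p) (~-trans (J′-~ z′) q))
           ; (there uv∈) z z′ p q → Separated-resp (m≤n⊔m N N′) ~-refl ~-refl
               (seps uv∈ z z′ p q) }

    separate : ∀ {K} → Embedding K → ∀ {i} → Avoidable i → ∀ m →
      ∃[ J ] ∃[ N ] Embedding J × (∀ z → J z ~[ m ] z) ×
      (∀ z z′ → Separated i N (K (J z)) (K (J z′)))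
    separate κ avoidable m =
      let us , cover = net m
          J , N , ι′ , J-~ , sep = separate-pairs κ avoidable m (cartesianProduct us us)
      in J , N , ι′ , J-~ , λ z z′ →
         let u , u∈ , z~u = cover z ; v , v∈ , z′~v = cover z′
         in sep (∈-cartesianProduct⁺ u∈ v∈) z z′ z~u z′~v

    -- Fusion and its limit

    module Fusion {a} (A : Pred ℕ a) (avoidable : ∀ {i} → A i → Avoidable i) where

      -- Stage `m` settles coordinate `m` for good: the separation covers all pairs of points, so no
      -- coordinate has to be revisited.
      step : ∀ {K} → Embedding K → ∀ m →
        ∃[ J ] Embedding J × (∀ z → J z ~[ m ] z) ×
        (A m → ∃[ N ] ∀ z z′ → Separated m N (K (J z)) (K (J z′)))
      step κ m with em {P = A m}
      ... | no ¬a = id , id-embedding , (λ _ → ~-refl) , λ a → contradiction a ¬a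
      ... | yes a = let J , N , ι′ , J-~ , sep = separate κ (avoidable a) m
                    in J , ι′ , J-~ , λ _ → N , sep

      stage : ℕ → Σ[ K ∈ (Pt → Pt) ] Embedding K
      stage zero    = id , id-embedding
      stage (suc m) = let K , κ = stage m ; J , ι′ , _ = step κ m in K ∘ J , ∘-embedding κ ι′

      K : ℕ → Pt → Pt
      K m = proj₁ (stage m)

      κ : ∀ m → Embedding (K m)
      κ m = proj₂ (stage m)

      -- Each step from stage `m` on fixes `m`-squares, hence so does their composition `q`.
      factor : ∀ m d → ∃[ q ] (∀ z → q z ~[ m ] z) × (∀ z → K (d + m) z ≡ K m (q z))
      factor m zero = id , (λ _ → ~-refl) , λ _ → refl
      factor m (suc d) =
        let J , _ , J-~ , _ = step (κ (d + m)) (d + m)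
            q , q-~ , eq = factor m d
        in q ∘ J , (λ z → ~-trans (q-~ (J z)) (~-anti (m≤n+m m d) (J-~ z))) , λ z → eq (J z)

      factor-≤ : ∀ {m t} → m ≤ t → ∃[ q ] (∀ z → q z ~[ m ] z) × (∀ z → K t z ≡ K m (q z))
      factor-≤ {m} {t} m≤t with factor m (t ∸ m)
      ... | f rewrite m∸n+n≡m m≤t = f

      -- The square of size `suc (k ⊔ n)` is the first to contain position `(k , n)`, and later
      -- stages do not change it.
      limit : Pt → Pt
      limit x k n = K (suc (k ⊔ n)) x k n

      limit-~ : ∀ m x → limit x ~[ m ] K m x
      limit-~ m x k n k< n< =
        let q , q-~ , eq = factor-≤ {t = m} (⊔-lub k< n<)
        in sym (trans (cong (λ y → y k n) (eq x))
             (Embedding.lipschitz-~ (κ (suc (k ⊔ n))) (q-~ x) k n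
               (s≤s (m≤m⊔n k n)) (s≤s (m≤n⊔m k n))))

      limit-embedding : Embedding limit
      limit-embedding = record
        { lipschitz = λ {m} p → Agree-trans (~⇒Agree (limit-~ m _))
            (Agree-trans (Embedding.lipschitz (κ m) p) (~⇒Agree (~-sym (limit-~ m _))))
        ; inverse = λ m →
            let N , inv = Embedding.inverse (κ m) m
                -- The modulus `N` of stage `m` may exceed `m`, beyond which `limit` and stage `m`
                -- can differ. Up to `t`, however, `limit x` is the value of stage `m` at `q x`, and
                -- `q` fixes the `m`-square.
                t = N ⊔ m
                q , q-~ , eq = factor-≤ {t = t} (m≤n⊔m N m)
                to-stage : ∀ x → limit x ~[ t ] K m (q x)
                to-stage x = subst (limit x ~[ t ]_) (eq x) (limit-~ t x)
            in t , λ {l} {x} {y} p → Agree-trans (~⇒Agree (~-sym (q-~ x)))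
                 (Agree-trans
                   (inv (Agree-anti (m≤m⊔n N m) ≼-refl
                     (Agree-trans (~⇒Agree (~-sym (to-stage x)))
                       (Agree-trans p (~⇒Agree (to-stage y))))))
                   (~⇒Agree (q-~ y)))
        }

      -- Up to the radius `N` of the separation, `limit x` is a value of stage `suc i`, namely at
      -- `q x`, and all values of that stage are separated.
      limit-separated : ∀ {i} → A i → ∀ x y → ¬ Equal i (limit x) (limit y)
      limit-separated {i} a x y =
        let _ , _ , _ , sep = step (κ i) i
            N , sep-N = sep a
            t = N ⊔ suc i
            q , q-~ , eq = factor-≤ {t = t} (m≤n⊔m N (suc i))
            to-stage : ∀ x → limit x ~[ t ] K (suc i) (q x)
            to-stage x = subst (limit x ~[ t ]_) (eq x) (limit-~ t x)
        in sep-N (q x) (q y) (limit x) (limit y)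
             (~-anti (m≤m⊔n N (suc i)) (to-stage x))
             (~-anti (m≤m⊔n N (suc i)) (to-stage y))

-- Boxes and initial segments in sequence spaces

module _ {A : Set} where

  private
    Seq = Space.Carrier (power (discrete A) (≡.setoid ℕ))

  box-bound : ∀ {B} {x : Seq} → x ∈ Box (discrete A) (≡.setoid ℕ) B →
    ∃[ N ] ∀ {y : Seq} → (∀ n → n < N → Func.to y n ≡ Func.to x n) →
      y ∈ Box (discrete A) (≡.setoid ℕ) B
  box-bound [] = 0 , λ _ → []
  box-bound {(n , O , _) ∷ B} {x} (p ∷ ps) =
    let N , f = box-bound {x = x} ps
    in suc n ⊔ N , λ {y} eq →
       subst O (sym (eq n (m≤m⊔n (suc n) N))) p ∷
       f {y} (λ n′ n′< → eq n′ (<-≤-trans n′< (m≤n⊔m (suc n) N)))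

  cylinder : ∀ (x : Seq) N → ∃[ B ] x ∈ Box (discrete A) (≡.setoid ℕ) B ×
    (∀ {y : Seq} → y ∈ Box (discrete A) (≡.setoid ℕ) B →
       ∀ n → n < N → Func.to y n ≡ Func.to x n)
  cylinder x zero = [] , [] , λ _ _ ()
  cylinder x (suc N) =
    let B , x∈B , f = cylinder x N
    in (N , (λ a → Lift _ (a ≡ Func.to x N)) , tt) ∷ B , lift refl ∷ x∈B ,
       λ { {y} (lift eq ∷ y∈B) n (s≤s n≤N) → go {y} eq (f {y} y∈B) (m≤n⇒m<n∨m≡n n≤N) }
    where
    go : ∀ {y : Seq} {n} → Func.to y N ≡ Func.to x N →
      (∀ n → n < N → Func.to y n ≡ Func.to x n) →
      n < N ⊎ n ≡ N → Func.to y n ≡ Func.to x n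
    go eq f (inj₁ n<N)  = f _ n<N
    go eq f (inj₂ refl) = eq

-- Strict extension of sequences

⊂-length : ∀ {s t} → s ⊂ t → length (toList s) < length (toList t)
⊂-length {s} (u , eq) = subst (length (toList s) <_)
  (sym (trans (Pointwise.Pointwise-length eq) (length-++ (toList s))))
  (m<m+n (length (toList s)) (s≤s z≤n))

⊂-trans : ∀ {s t r} → s ⊂ t → t ⊂ r → s ⊂ r
⊂-trans {s} {t} {r} (u , eq) (u′ , eq′) = u ⁺++⁺ u′ ,
  T.trans {r} {t ⁺++⁺ u′} {s ⁺++⁺ (u ⁺++⁺ u′)} eq′
    (subst (Pointwise.Pointwise _ (toList t ++ toList u′)) 
        (++-assoc (toList s) (toList u) (toList u′))
      (Pointwise.++⁺ eq (T.refl {u′})))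

⊂-respʳ : ∀ {s t r} → t T.≈ r → s ⊂ t → s ⊂ r
⊂-respʳ {s} {t} {r} t≈r (u , eq) =
  u , T.trans {r} {t} {s ⁺++⁺ u} (T.sym {t} {r} t≈r) eq

⊂-respˡ : ∀ {s t r} → s T.≈ t → s ⊂ r → t ⊂ r
⊂-respˡ {s} {t} {r} s≈t (u , eq) =
  u , T.trans {r} {s ⁺++⁺ u} {t ⁺++⁺ u} eq (Pointwise.++⁺ s≈t (T.refl {u}))

-- The topology of `D^ θ` in terms of balls

module _ (θ : Ξ) where

  private
    Coord = ∣ Ξ.setoid θ ∣

  open Injection (Ξ.countable θ) public
    using () renaming (to to code; cong to code-cong; injective to code-injective)

  bit : Point θ → Coord → ℕ → Fin 2
  bit x i = Func.to (x [ i ])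

  bit-cong : ∀ x {i j} → proj₁ i T.≈ proj₁ j → ∀ n → bit x i n ≡ bit x j n
  bit-cong x {i} {j} i≈j = Func.cong x {i} {j} i≈j

  Near : ℕ → Point θ → Point θ → Set₁
  Near N x y = ∀ i n → code i < N → n < N → bit y i n ≡ bit x i n

  open Space (D^ θ) using (Open; _≈_)

  ≈⇒Near : ∀ {N x y} → y ≈ x → Near N x y
  ≈⇒Near eq i n _ _ = eq i n

  Near-anti : ∀ {N M x y} → N ≤ M → Near M x y → Near N x y
  Near-anti N≤M p i n i< n< = p i n (<-≤-trans i< N≤M) (<-≤-trans n< N≤M)

  Box-Near : ∀ {B x} → x ∈ Box D (Ξ.setoid θ) B →
    ∃[ N ] ∀ {y} → Near N x y → y ∈ Box D (Ξ.setoid θ) B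
  Box-Near [] = 0 , λ _ → []
  Box-Near {(i , O , o) ∷ _} {x} (p ∷ ps) =
    let B , x∈B , B⊆O = o (x [ i ]) p
        N , f = box-bound {x = x [ i ]} x∈B
        N′ , g = Box-Near {x = x} ps
        M = suc (code i) ⊔ N
    in M ⊔ N′ , λ {y} near →
       B⊆O (f {y [ i ]} (λ n n< → near i n
              (<-≤-trans (m≤m⊔n (suc (code i)) N) (m≤m⊔n M N′))
              (<-≤-trans (<-≤-trans n< (m≤n⊔m (suc (code i)) N)) (m≤m⊔n M N′)))) ∷
       g {y} (Near-anti {x = x} {y} (m≤n⊔m M N′) near)

  Open⇒Near : ∀ {O} → Open O → ∀ {x} → x ∈ O → ∃[ N ] ∀ {y} → Near N x y → y ∈ O
  Open⇒Near o {x} x∈O =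
    let B , x∈B , B⊆O = o x x∈O
        N , f = Box-Near {x = x} x∈B
    in N , λ {y} near → B⊆O (f {y} near)

  module _ (em : ∀ {a} → ExcludedMiddle a) where

    -- Induction on the bound `M` for codes with the number `N` of bits fixed. A box must name
    -- actual coordinates, so excluded middle decides whether the next number is a code.
    Near-Box : ∀ N M x → ∃[ B ] x ∈ Box D (Ξ.setoid θ) B ×
      (∀ {y} → y ∈ Box D (Ξ.setoid θ) B →
         ∀ i n → code i < M → n < N → bit y i n ≡ bit x i n)
    Near-Box N zero x = [] , [] , λ _ _ _ ()
    Near-Box N (suc M) x with Near-Box N M x | em {P = ∃[ i ] code i ≡ M}
    ... | B , x∈B , f | no none = B , x∈B , λ { {y} y∈B i n (s≤s i≤M) n< →
          go {y} (f {y} y∈B) i n (m≤n⇒m<n∨m≡n i≤M) n< }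
      where
      go : ∀ {y} → (∀ i n → code i < M → n < N → bit y i n ≡ bit x i n) →
        ∀ i n → code i < M ⊎ code i ≡ M → n < N → bit y i n ≡ bit x i n
      go f i n (inj₁ i<M) n< = f i n i<M n<
      go f i n (inj₂ eq) _   = contradiction (i , eq) none
    ... | B , x∈B , f | yes (j , refl) =
          (j , (λ z → Lift _ (∀ n → n < N → Func.to z n ≡ bit x j n)) , O-open) ∷ B ,
          lift (λ _ _ → refl) ∷ x∈B ,
          λ { {y} (lift p ∷ y∈B) i n (s≤s i≤M) n< →
              go {y} p (f {y} y∈B) i n (m≤n⇒m<n∨m≡n i≤M) n< }
      where
      O-open : Space.Open D (λ z → Lift _ (∀ n → n < N → Func.to z n ≡ bit x j n))
      O-open z (lift p) =
        let B , z∈B , g = cylinder z N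
        in B , z∈B , λ {w} w∈B → lift λ n n< → trans (g {w} w∈B n n<) (p n n<)
      go : ∀ {y} → (∀ n → n < N → bit y j n ≡ bit x j n) →
        (∀ i n → code i < M → n < N → bit y i n ≡ bit x i n) →
        ∀ i n → code i < M ⊎ code i ≡ M → n < N → bit y i n ≡ bit x i n
      go {y} p f i n (inj₁ i<M) n< = f i n i<M n<
      go {y} p f i n (inj₂ eq) n<  =
        trans (bit-cong y {i} {j} (code-injective eq) n)
          (trans (p n n<) (sym (bit-cong x {i} {j} (code-injective eq) n)))

    Near⇒Open : ∀ {O} → (∀ {x} → x ∈ O → ∃[ N ] ∀ {y} → Near N x y → y ∈ O) → Open O
    Near⇒Open nbhd x x∈O =
      let N , f = nbhd x∈O
          B , x∈B , g = Near-Box N N x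
      in B , x∈B , λ {y} y∈B → f (g {y} y∈B)

    Ball-open : ∀ N x → Open (Near N x)
    Ball-open N x = Near⇒Open λ near → N , λ near′ i n i< n< →
      trans (near′ i n i< n<) (near i n i< n<)

    ContinuousAt : (Point θ → Point θ) → Set₁
    ContinuousAt M = ∀ x m → ∃[ N ] ∀ {y} → Near N x y → Near m (M x) (M y)

    Continuous⇒At : ∀ {M} → Continuous (D^ θ) (D^ θ) M → ContinuousAt M
    Continuous⇒At {M} c x m =
      Open⇒Near (c (Near m (M x)) (Ball-open m (M x))) {x} λ _ _ _ _ → refl

    At⇒Continuous : ∀ {M} → ContinuousAt M → Continuous (D^ θ) (D^ θ) M
    At⇒Continuous {M} c O o = Near⇒Open λ {x} Mx∈O →
      let m , f = Open⇒Near o Mx∈O ; N , g = c x m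
      in N , λ near → f (g near)

    𝒩-continuous⇒At : ∀ {F : Point θ → Space.Carrier 𝒩} → Continuous (D^ θ) 𝒩 F →
      ∀ x n → ∃[ N ] ∀ {y} → Near N x y → Func.to (F y) n ≡ Func.to (F x) n
    𝒩-continuous⇒At {F} c x n =
      let N , f = Open⇒Near (c O O-open) {x} (lift refl)
      in N , λ near → Lift.lower (f near)
      where
      O : Pred (Space.Carrier 𝒩) (lsuc 0ℓ)
      O z = Lift _ (Func.to z n ≡ Func.to (F x) n)
      O-open : Space.Open 𝒩 O
      O-open z z∈O = (n , (λ a → Lift _ (a ≡ Func.to (F x) n)) , tt) ∷ [] , z∈O ∷ [] ,
        λ { (p ∷ []) → p }

    -- Images of projection-preserving maps

    module _ {M : Point θ → Point θ}
      (M-continuous : ContinuousAt M)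
      (M⁻¹-continuous : ∀ x m → ∃[ N ] ∀ {y} → Near N (M x) (M y) → Near m x y)
      (M-preserves : ∀ (ξ : Ξ) (ξ⊑θ : ξ ⊑ θ) x y →
        Space._≈_ (D^ ξ) (restrict {ξ} {θ} ξ⊑θ x) (restrict {ξ} {θ} ξ⊑θ y) ⇔
        Space._≈_ (D^ ξ) (restrict {ξ} {θ} ξ⊑θ (M x)) (restrict {ξ} {θ} ξ⊑θ (M y))) where

      Image : Pred (Point θ) (lsuc 0ℓ)
      Image y = ∃[ x ] y ≈ M x

      private
        ≈-from-Near : ∀ {x y} → (∀ m → Near m x y) → y ≈ x
        ≈-from-Near near i n =
          near (suc (code i ⊔ n)) i n (s≤s (m≤m⊔n (code i) n)) (s≤s (m≤n⊔m (code i) n))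

        -- Equality of points is nearness at every radius, so continuity gives congruence, and
        -- continuity of the inverse gives injectivity.
        M-cong : ∀ {x y} → x ≈ y → M x ≈ M y
        M-cong {x} {y} eq = ≈-from-Near {M y} {M x} λ m →
          proj₂ (M-continuous y m) {x} (≈⇒Near {x = y} {x} eq)

        M-injective : ∀ {x y} → M x ≈ M y → x ≈ y
        M-injective {x} {y} eq = ≈-from-Near {y} {x} λ m →
          proj₂ (M⁻¹-continuous y m) {x} (≈⇒Near {x = M y} {M x} eq)

        module S = Setoid (Space.setoid (D^ θ))

      Image-IPS : IPS θ Image
      Image-IPS = record
        { respects = λ { {y} {y′} y≈y′ (x , y≈Mx) →
            x , S.trans {y′} {y} {M x} (S.sym {y} {y′} y≈y′) y≈Mx }
        ; homeomorphism = record
          { inverse = record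
            { to        = λ x → M x , x , S.refl {M x}
            ; from      = λ (_ , x , _) → x
            ; to-cong   = λ {x} {y} → M-cong {x} {y}
            ; from-cong = λ { {y , x , y≈Mx} {y′ , x′ , y′≈Mx′} y≈y′ →
                M-injective {x} {x′} (S.trans {M x} {y} {M x′} (S.sym {y} {M x} y≈Mx)
                  (S.trans {y} {y′} {M x′} y≈y′ y′≈Mx′)) }
            ; inverse   = (λ { {y , x , y≈Mx} {z} z≈x →
                               S.trans {M z} {M x} {y} (M-cong {z} {x} z≈x) (S.sym {y} {M x} y≈Mx) })
                        , (λ { {z} {y , x , y≈Mx} y≈Mz →
                               M-injective {x} {z}
                                 (S.trans {M x} {y} {M z} (S.sym {y} {M x} y≈Mx) y≈Mz) })
            }
          ; to-continuous   = λ O (W , w , to , from) →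
              Space.open-resp-≐ (D^ θ) {W ∘ M} {λ x → O (M x , x , S.refl {M x})}
                (from , to) (At⇒Continuous M-continuous W w)
          ; from-continuous = inverse-open
          }
        ; preserves = M-preserves
        }
        where
        inverse-open : ∀ O → Open O → Space.Open (subspace (D^ θ) Image) (λ (_ , x , _) → O x)
        inverse-open O o = W , W-open , (λ {p} → in-W {p}) , (λ {p} → from-W {p})
          where
          -- The union of all balls around points `M x` that meet the image only in values of `M` on
          -- `O`.
          W : Pred (Point θ) (lsuc 0ℓ)
          W y = ∃[ x ] ∃[ N ] (∀ {z} → Near N (M x) (M z) → O z) × Near N (M x) y
          W-open : Open W
          W-open = Near⇒Open λ (x , N , f , near) → N , λ near′ →
            x , N , f , λ i n i< n< → trans (near′ i n i< n<) (near i n i< n<)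
          in-W : ∀ {p : Σ[ y ∈ Point θ ] Image y} → O (proj₁ (proj₂ p)) → W (proj₁ p)
          in-W {y , x , y≈Mx} x∈O =
            let m , f = Open⇒Near o {x} x∈O ; N , g = M⁻¹-continuous x m
            in x , N , (λ {z} near → f {z} (g {z} near)) , ≈⇒Near {x = M x} {y} y≈Mx
          from-W : ∀ {p : Σ[ y ∈ Point θ ] Image y} → W (proj₁ p) → O (proj₁ (proj₂ p))
          from-W {y , x , y≈Mx} (x′ , N , f , near) = f {x} λ i n i< n< →
            trans (sym (y≈Mx i n)) (near i n i< n<)

    -- The tree order on codes and the passage between `Point θ` and `Pt`

    _≼_ : Rel ℕ (lsuc 0ℓ)
    k ≼ l = k ≡ l ⊎ (∃[ i ] ∃[ j ] code i ≡ k × code j ≡ l × proj₁ i ⊂ proj₁ j)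

    ≼-refl : Reflexive _≼_
    ≼-refl = inj₁ refl

    ≼-trans : IsTransitive _≼_
    ≼-trans (inj₁ refl) q = q
    ≼-trans p (inj₁ refl) = p
    ≼-trans (inj₂ (i , j , refl , refl , i⊂j)) (inj₂ (j′ , l , eq , refl , j′⊂l)) =
      inj₂ (i , l , refl , refl ,
        ⊂-trans {proj₁ i} {proj₁ j′} {proj₁ l}
          (⊂-respʳ {proj₁ i} {proj₁ j} {proj₁ j′}
            (T.sym {proj₁ j′} {proj₁ j} (code-injective eq)) i⊂j)
          j′⊂l)

    -- Length grows strictly along `⊂`, so two strict extensions in opposite directions are
    -- impossible.
    ≼-antisym : Antisymmetric _≡_ _≼_
    ≼-antisym (inj₁ eq) _ = eq
    ≼-antisym _ (inj₁ eq) = sym eq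
    ≼-antisym (inj₂ (i , j , refl , refl , i⊂j)) (inj₂ (j′ , i′ , eq , eq′ , j′⊂i′)) =
      contradiction
        (<-trans (⊂-length {proj₁ i} {proj₁ j} i⊂j)
          (subst (_< length (toList (proj₁ i))) (same-length j′ j eq)
            (subst (length (toList (proj₁ j′)) <_) (same-length i′ i eq′)
              (⊂-length {proj₁ j′} {proj₁ i′} j′⊂i′))))
        (<-irrefl refl)
      where
      same-length : ∀ (i j : Coord) → code i ≡ code j →
        length (toList (proj₁ i)) ≡ length (toList (proj₁ j))
      same-length i j eq = Pointwise.Pointwise-length (code-injective {i} {j} eq)

    open Embeddings em _≼_ (λ {k} → ≼-refl {k}) (λ {k} {l} {m} → ≼-trans {k} {l} {m}) public

    fromPt : Pt → Point θ
    fromPt x = record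
      { to   = λ i → record { to = x (code i) ; cong = cong (x (code i)) }
      ; cong = λ {i} {j} i≈j n → cong (λ k → x k n) (code-cong {i} {j} i≈j)
      }

    -- Numbers that are not codes are dummy coordinates with default value zero; `fromPt` forgets
    -- them, so `toPt (fromPt z)` need equal `z` only at codes.
    toPt : Point θ → Pt
    toPt x k n with em {P = ∃[ i ] code i ≡ k}
    ... | yes (i , _) = bit x i n
    ... | no _        = zero

    toPt-code : ∀ x i n → toPt x (code i) n ≡ bit x i n
    toPt-code x i n with em {P = ∃[ j ] code j ≡ code i}
    ... | yes (j , eq) = bit-cong x {j} {i} (code-injective eq) n
    ... | no none      = contradiction (i , refl) none

    toPt-~ : ∀ {N x y} → Near N x y → toPt x ~[ N ] toPt y
    toPt-~ near k n k< n< with em {P = ∃[ i ] code i ≡ k}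
    ... | yes (i , refl) = sym (near i n k< n<)
    ... | no _           = refl

    Near-toPt : ∀ {N} x y → (∀ i → Agree N (code i) (toPt x) (toPt y)) → Near N x y
    Near-toPt x y agree i n i< n< =
      trans (sym (toPt-code y i n)) (trans (sym (agree i (code i) n ≼-refl i< n<)) (toPt-code x i n))

    ≼-code : ∀ {k i} → k ≼ code i →
      ∃[ j ] code j ≡ k × (proj₁ j T.≈ proj₁ i ⊎ proj₁ j ⊂ proj₁ i)
    ≼-code {i = i} (inj₁ refl) = i , refl , inj₁ (T.refl {proj₁ i})
    ≼-code {i = i} (inj₂ (j , i′ , eq , eq′ , j⊂i′)) =
      j , eq , inj₂ (⊂-respʳ {proj₁ j} {proj₁ i′} {proj₁ i} (code-injective eq′) j⊂i′)

    toPt-fromPt : ∀ {z i} → toPt (fromPt z) ≈[ code i ] z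
    toPt-fromPt {z} {i} k n k≼ with ≼-code {i = i} k≼
    ... | j , refl , _ = toPt-code (fromPt z) j n

    module _ (ξ : Ξ) (ξ⊑θ : ξ ⊑ θ) where

      RestrictEqual LowerEqual : Point θ → Point θ → Set₁
      RestrictEqual x y = Space._≈_ (D^ ξ) (restrict {ξ} {θ} ξ⊑θ x) (restrict {ξ} {θ} ξ⊑θ y)
      LowerEqual x y = ∀ i → proj₁ i ∈ Ξ.mem ξ → toPt x ≈[ code i ] toPt y

      lower-member : ∀ {i j : Coord} → proj₁ i ∈ Ξ.mem ξ →
        proj₁ j T.≈ proj₁ i ⊎ proj₁ j ⊂ proj₁ i → proj₁ j ∈ Ξ.mem ξ
      lower-member {i} {j} i∈ξ (inj₁ j≈i) =
        Ξ.respects ξ {proj₁ i} {proj₁ j} (T.sym {proj₁ j} {proj₁ i} j≈i) i∈ξ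
      lower-member {i} {j} i∈ξ (inj₂ j⊂i) = Ξ.closed ξ {proj₁ j} {proj₁ i} j⊂i i∈ξ

      -- `ξ` is closed downward, so everything below one of its members is again a coordinate of the
      -- restriction.
      restrict⇒lower : ∀ {x y} → RestrictEqual x y → LowerEqual x y
      restrict⇒lower {x} {y} eq i i∈ξ k n k≼ with ≼-code {i = i} k≼
      ... | j , refl , j≤i =
        let t∈ξ = lower-member {i} {j} i∈ξ j≤i
            j′ = proj₁ j , ξ⊑θ t∈ξ
            j≈j′ = T.refl {proj₁ j}
        in trans (toPt-code x j n)
             (trans (bit-cong x {j} {j′} j≈j′ n)
               (trans (eq (proj₁ j , t∈ξ) n)
                 (trans (bit-cong y {j′} {j} j≈j′ n) (sym (toPt-code y j n)))))

      lower⇒restrict : ∀ {x y} → LowerEqual x y → RestrictEqual x y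
      lower⇒restrict {x} {y} eq (t , t∈ξ) n =
        let i = t , ξ⊑θ t∈ξ
        in trans (sym (toPt-code x i n)) (trans (eq i t∈ξ (code i) n ≼-refl) (toPt-code y i n))

    ↓⊑ : ∀ i {t} → t T.≈ proj₁ i ⊎ t ⊂ proj₁ i → t ∈ Ξ.mem θ
    ↓⊑ i {t} (inj₁ t≈i) = Ξ.respects θ {proj₁ i} {t} (T.sym {t} {proj₁ i} t≈i) (proj₂ i)
    ↓⊑ i {t} (inj₂ t⊂i) = Ξ.closed θ {t} {proj₁ i} t⊂i (proj₂ i)

    -- Principal initial segments are the instances of `ξ` at which preservation of projections
    -- becomes a statement about `≈[ code i ]`.
    ↓ : Coord → Ξ
    ↓ i = record
      { mem       = λ t → t T.≈ proj₁ i ⊎ t ⊂ proj₁ i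
      ; respects  = λ { {s} {t} s≈t (inj₁ s≈i) →
                          inj₁ (T.trans {t} {s} {proj₁ i} (T.sym {s} {t} s≈t) s≈i)
                      ; {s} {t} s≈t (inj₂ s⊂i) → inj₂ (⊂-respˡ {s} {t} {proj₁ i} s≈t s⊂i) }
      ; countable = record
        { to = λ (t , p) → code (t , ↓⊑ i {t} p)
        ; cong = λ { {s , p} {t , q} s≈t → code-cong {s , ↓⊑ i {s} p} {t , ↓⊑ i {t} q} s≈t }
        ; injective = λ eq → code-injective eq
        }
      ; closed    = λ { {s} {t} s⊂t (inj₁ t≈i) → inj₂ (⊂-respʳ {s} {t} {proj₁ i} t≈i s⊂t)
                      ; {s} {t} s⊂t (inj₂ t⊂i) → inj₂ (⊂-trans {s} {t} {proj₁ i} s⊂t t⊂i) }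
      }

    -- Transporting `H` to `Pt` and composing it with embeddings

    module Composite (H : Point θ → Point θ)
      (H-continuous : ContinuousAt H)
      (H⁻¹-continuous : ∀ x m → ∃[ N ] ∀ {y} → Near N (H x) (H y) → Near m x y)
      (H-preserves : ∀ (ξ : Ξ) (ξ⊑θ : ξ ⊑ θ) x y →
        RestrictEqual ξ ξ⊑θ x y ⇔ RestrictEqual ξ ξ⊑θ (H x) (H y)) where

      -- Dummy coordinates are copied rather than made constant, so that `extend-lower⁻¹` holds at
      -- them as well.
      extend : Pt → Pt
      extend x k with em {P = ∃[ i ] code i ≡ k}
      ... | yes (i , _) = bit (H (fromPt x)) i
      ... | no _        = x k

      extend-bit : ∀ x i n → extend x (code i) n ≡ bit (H (fromPt x)) i n
      extend-bit x i n with em {P = ∃[ j ] code j ≡ code i}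
      ... | yes (j , eq) = bit-cong (H (fromPt x)) {j} {i} (code-injective eq) n
      ... | no none      = contradiction (i , refl) none

      extend-other : ∀ x {k} n → ¬ (∃[ i ] code i ≡ k) → extend x k n ≡ x k n
      extend-other x {k} n none with em {P = ∃[ i ] code i ≡ k}
      ... | yes found = contradiction found none
      ... | no _      = refl

      ≼-other : ∀ {k l} → ¬ (∃[ i ] code i ≡ l) → k ≼ l → k ≡ l
      ≼-other none (inj₁ eq) = eq
      ≼-other none (inj₂ (_ , j , _ , eq , _)) = contradiction (j , eq) none

      ≈-sym : ∀ {l x y} → x ≈[ l ] y → y ≈[ l ] x
      ≈-sym p k n k≼ = sym (p k n k≼)

      ≈-trans : ∀ {l x y z} → x ≈[ l ] y → y ≈[ l ] z → x ≈[ l ] z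
      ≈-trans p q k n k≼ = trans (p k n k≼) (q k n k≼)

      extend-≈ : ∀ {x i} → extend x ≈[ code i ] toPt (H (fromPt x))
      extend-≈ {x} {i} k n k≼ with ≼-code {i = i} k≼
      ... | j , refl , _ = trans (extend-bit x j n) (sym (toPt-code (H (fromPt x)) j n))

      self : ∀ i → proj₁ i ∈ Ξ.mem (↓ i)
      self i = inj₁ (T.refl {proj₁ i})

      lower-≼ : ∀ {i j} → proj₁ j ∈ Ξ.mem (↓ i) → code j ≼ code i
      lower-≼ {i} {j} (inj₁ j≈i) = inj₁ (code-cong {j} {i} j≈i)
      lower-≼ {i} {j} (inj₂ j⊂i) = inj₂ (j , i , refl , refl , j⊂i)

      ↓-equal : ∀ {x y i} → toPt x ≈[ code i ] toPt y →
        RestrictEqual (↓ i) (λ {t} → ↓⊑ i {t}) x y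
      ↓-equal {x} {y} {i} p = lower⇒restrict (↓ i) (λ {t} → ↓⊑ i {t}) {x} {y}
        λ j j∈ k n k≼ → p k n (≼-trans k≼ (lower-≼ {i} {j} j∈))

      ↓-equal⁻¹ : ∀ {x y i} → RestrictEqual (↓ i) (λ {t} → ↓⊑ i {t}) x y →
        toPt x ≈[ code i ] toPt y
      ↓-equal⁻¹ {x} {y} {i} eq =
        restrict⇒lower (↓ i) (λ {t} → ↓⊑ i {t}) {x} {y} eq i (self i)

      H-equal : ∀ x y i → toPt x ≈[ code i ] toPt y ⇔ toPt (H x) ≈[ code i ] toPt (H y)
      H-equal x y i = mk⇔
        (λ p → ↓-equal⁻¹ {H x} {H y} {i} (Equivalence.to equiv (↓-equal {x} {y} {i} p)))
        (λ p → ↓-equal⁻¹ {x} {y} {i} (Equivalence.from equiv (↓-equal {H x} {H y} {i} p)))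
        where equiv = H-preserves (↓ i) (λ {t} → ↓⊑ i {t}) x y

      extend-lower : ∀ {l x y} → x ≈[ l ] y → extend x ≈[ l ] extend y
      extend-lower {l} {x} {y} p with em {P = ∃[ i ] code i ≡ l}
      ... | yes (i , refl) =
        ≈-trans (extend-≈ {x} {i})
          (≈-trans
            (Equivalence.to (H-equal (fromPt x) (fromPt y) i)
              (≈-trans (toPt-fromPt {x} {i}) (≈-trans p (≈-sym (toPt-fromPt {y} {i})))))
            (≈-sym (extend-≈ {y} {i})))
      ... | no none = λ k n k≼l → go k n (≼-other none k≼l)
        where
        go : ∀ k n → k ≡ l → extend x k n ≡ extend y k n
        go k n refl = trans (extend-other x n none)
          (trans (p k n ≼-refl) (sym (extend-other y n none)))

      extend-lower⁻¹ : ∀ {l x y} → extend x ≈[ l ] extend y → x ≈[ l ] y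
      extend-lower⁻¹ {l} {x} {y} p with em {P = ∃[ i ] code i ≡ l}
      ... | yes (i , refl) =
        ≈-trans (≈-sym (toPt-fromPt {x} {i}))
          (≈-trans
            (Equivalence.from (H-equal (fromPt x) (fromPt y) i)
              (≈-trans (≈-sym (extend-≈ {x} {i})) (≈-trans p (extend-≈ {y} {i}))))
            (toPt-fromPt {y} {i}))
      ... | no none = λ k n k≼l → go k n (≼-other none k≼l)
        where
        go : ∀ k n → k ≡ l → x k n ≡ y k n
        go k n refl = trans (sym (extend-other x n none))
          (trans (p k n ≼-refl) (extend-other y n none))

      fromPt-Near : ∀ {N x y} → y ~[ N ] x → Near N (fromPt x) (fromPt y)
      fromPt-Near p i n i< n< = p (code i) n i< n<

      extend-continuous : ∀ x k n → ∃[ N ] ∀ y → y ~[ N ] x → extend y k n ≡ extend x k n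
      extend-continuous x k n with em {P = ∃[ i ] code i ≡ k}
      ... | yes (i , refl) =
        let N , f = H-continuous (fromPt x) (suc (code i ⊔ n))
        in N , λ y y~x → f {fromPt y} (fromPt-Near {x = x} {y} y~x) i n
             (s≤s (m≤m⊔n (code i) n)) (s≤s (m≤n⊔m (code i) n))
      ... | no _ = suc (k ⊔ n) , λ y y~x → y~x k n (s≤s (m≤m⊔n k n)) (s≤s (m≤n⊔m k n))

      module _ {K} (embedding : Embedding K) where
        open Embedding embedding

        composite : Point θ → Point θ
        composite x = H (fromPt (K (toPt x)))

        composite-continuous : ContinuousAt composite
        composite-continuous x m =
          let N , f = H-continuous (fromPt (K (toPt x))) m
          in N , λ {y} near → f {fromPt (K (toPt y))}
               (fromPt-Near {x = K (toPt x)} {K (toPt y)}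
                 (~-sym (lipschitz-~ (toPt-~ {x = x} {y} near))))

        -- The modulus `inverse` does not depend on `l`, so one `N` serves all coordinates `i`.
        composite⁻¹-continuous : ∀ x m →
          ∃[ N ] ∀ {y} → Near N (composite x) (composite y) → Near m x y
        composite⁻¹-continuous x m =
          let N , inv = inverse m
              N′ , f = H⁻¹-continuous (fromPt (K (toPt x))) N
          in N′ , λ {y} near → Near-toPt x y λ i → inv λ k n k≼ k< n< →
               let j , eq , _ = ≼-code {i = i} k≼
               in at-code {x = K (toPt x)} {K (toPt y)} (f {fromPt (K (toPt y))} near) j eq k< n<
          where
          at-code : ∀ {N x y k n} → Near N (fromPt x) (fromPt y) → ∀ j → code j ≡ k →
            k < N → n < N → x k n ≡ y k n
          at-code near j refl k< n< = sym (near j _ k< n<)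

        composite-preserves : ∀ (ξ : Ξ) (ξ⊑θ : ξ ⊑ θ) x y →
          RestrictEqual ξ ξ⊑θ x y ⇔ RestrictEqual ξ ξ⊑θ (composite x) (composite y)
        composite-preserves ξ ξ⊑θ x y = mk⇔
          (λ eq → Equivalence.to equiv (lower⇒restrict ξ ξ⊑θ {x′} {y′} λ i i∈ξ →
            ≈-trans (toPt-fromPt {i = i})
              (≈-trans (lipschitz-≈ (restrict⇒lower ξ ξ⊑θ {x} {y} eq i i∈ξ))
                (≈-sym (toPt-fromPt {i = i})))))
          (λ eq → lower⇒restrict ξ ξ⊑θ {x} {y} λ i i∈ξ → inverse-≈
            (≈-trans (≈-sym (toPt-fromPt {i = i}))
              (≈-trans (restrict⇒lower ξ ξ⊑θ {x′} {y′} (Equivalence.from equiv eq) i i∈ξ)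
                (toPt-fromPt {i = i}))))
          where
          x′ y′ : Point θ
          x′ = fromPt (K (toPt x))
          y′ = fromPt (K (toPt y))
          equiv = H-preserves ξ ξ⊑θ x′ y′

        composite-IPS : IPS θ (λ y → ∃[ x ] y ≈ composite x)
        composite-IPS =
          Image-IPS {M = composite} composite-continuous composite⁻¹-continuous composite-preserves

    -- The dichotomy for a continuous function on `D^ θ`

    module _ (X : Pred (Point θ) (lsuc 0ℓ)) (ips : IPS θ X)
      (F : Space.setoid (D^ θ) ⟶ Space.setoid 𝒩)
      (F-continuous : Continuous (D^ θ) 𝒩 (Func.to F)) where

      private
        module X = IPS ips
        module Φ = Homeomorphism X.homeomorphism
        module Φ⁻¹ = Inverse Φ.inverse

      H : Point θ → Point θ
      H x = proj₁ (Φ.to x)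

      H-continuous : ContinuousAt H
      H-continuous = Continuous⇒At {H} λ O o → Φ.to-continuous (O ∘ proj₁) (O , o , id , id)

      -- The pullback of a ball along the inverse is the trace of an open set `W` of `D^ θ`; a ball
      -- around `H x` inside `W` gives `N`.
      H⁻¹-continuous : ∀ x m → ∃[ N ] ∀ {y} → Near N (H x) (H y) → Near m x y
      H⁻¹-continuous x m =
        let W , w , to , from = Φ.from-continuous (Near m x) (Ball-open m x)
            N , f = Open⇒Near w {H x} (to {Φ.to x} λ i n _ _ → Φ⁻¹.strictlyInverseʳ x i n)
        in N , λ {y} near i n i< n< →
             trans (sym (Φ⁻¹.strictlyInverseʳ y i n)) (from {Φ.to y} (f {H y} near) i n i< n<)

      open Composite H H-continuous H⁻¹-continuous X.preserves

      G : Pt → ℕ → ℕ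
      G x = Func.to (Func.to F (H (fromPt x)))

      G-continuous : ∀ x n → ∃[ N ] ∀ y → y ~[ N ] x → G y n ≡ G x n
      G-continuous x n =
        let m , f = 𝒩-continuous⇒At {Func.to F} F-continuous (H (fromPt x)) n
            N , g = H-continuous (fromPt x) m
        in N , λ y y~x → f {H (fromPt y)} (g {fromPt y} (fromPt-Near {x = x} {y} y~x))

      composite⊆X : ∀ {K} (κ : Embedding K) → (λ y → ∃[ x ] y ≈ composite κ x) ⊆ X
      composite⊆X {K} κ {y} (x , y≈) = X.respects {composite κ x} {y}
        (Setoid.sym (Space.setoid (D^ θ)) {y} {composite κ x} y≈)
        (proj₂ (Φ.to (fromPt (K (toPt x)))))

      Conclusion : Set₂
      Conclusion = ∃[ Y ] IPS θ Y × Y ⊆ X ×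
        ( (∀ i y → y ∈ Y → Func.to F y ∉ (Y ⇓ i))
        ⊎ (∃[ j ] (∀ y → y ∈ Y → Space._≈_ 𝒩 (Func.to F y) (ι (y [ j ])))
                × (∀ i → ¬ (Ξ._≈_ θ i j) →
                   ∀ y → y ∈ Y → Func.to F y ∉ (Y ⇓ i))))

      module Sep = Separation (λ {k} {l} → ≼-antisym {k} {l}) G extend
        G-continuous extend-continuous extend-lower extend-lower⁻¹

      F≗G : ∀ {K} (κ : Embedding K) {x y} → y ≈ composite κ x →
        ∀ n → Func.to (Func.to F y) n ≡ G (K (toPt x)) n
      F≗G κ {x} {y} y≈ = Func.cong F {y} {composite κ x} y≈

      avoided : ∀ {K} (κ : Embedding K) {i} →
        (∀ z z′ → ¬ Sep.Equal (code i) (K z) (K z′)) →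
        ∀ y → (∃[ x ] y ≈ composite κ x) →
        Func.to F y ∉ ((λ y → ∃[ x ] y ≈ composite κ x) ⇓ i)
      avoided {K} κ {i} sep y (x , y≈) (y′ , (x′ , y′≈) , Fy≈) =
        sep (toPt x) (toPt x′) λ n → trans (sym (F≗G κ {x} {y} y≈ n))
          (trans (Fy≈ n) (cong toℕ (trans (y′≈ i n) (sym (extend-bit (K (toPt x′)) i n)))))

      equal⇒projection : ∀ {K} (κ : Embedding K) {j} →
        (∀ z → Sep.Equal (code j) (K z) (K z)) →
        ∀ y → (∃[ x ] y ≈ composite κ x) → Space._≈_ 𝒩 (Func.to F y) (ι (y [ j ]))
      equal⇒projection {K} κ {j} equal y (x , y≈) n =
        trans (F≗G κ {x} {y} y≈ n) (trans (equal (toPt x) n)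
          (cong toℕ (trans (extend-bit (K (toPt x)) j n) (sym (y≈ j n)))))

      conclusion : Conclusion
      conclusion with em {P = ∃[ j ] ∃[ K ] Embedding K × (∀ z → Sep.Equal (code j) (K z) (K z))}
      ... | no none =
        _ , composite-IPS limit-embedding , (λ {y} → composite⊆X limit-embedding {y}) ,
        inj₁ λ i → avoided limit-embedding {i} (limit-separated (i , refl))
        where
        -- The failed alternative speaks of elements of `θ`, so the fusion runs over codes only.
        avoidable : ∀ {k} → ∃[ i ] code i ≡ k → Sep.Avoidable k
        avoidable (i , refl) κ equal = none (i , _ , κ , equal)
        open Sep.Fusion (λ k → ∃[ i ] code i ≡ k) avoidable
          using (limit; limit-embedding; limit-separated)
      ... | yes (j , K , κ , equal) =
        _ , composite-IPS κ′ , (λ {y} → composite⊆X κ′ {y}) ,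
        inj₂ (j , equal⇒projection κ′ {j} (λ z → equal (limit z)) ,
          -- As `G ∘ K` is `hⱼ`, a value of `F` in the projection to `i` would make coordinate `j`
          -- at one point equal to coordinate `i` at another, which the second fusion excludes.
          λ i i≉j → avoided κ′ {i} λ z z′ e →
            limit-separated {code i} (λ eq → i≉j (code-injective eq)) z z′
              λ n → trans (sym (equal (limit z) n)) (e n))
        where
        h : Pt → Pt
        h x = extend (K x)
        h-lower : ∀ {l x y} → x ≈[ l ] y → h x ≈[ l ] h y
        h-lower p = extend-lower (Embedding.lipschitz-≈ κ p)
        h-lower⁻¹ : ∀ {l x y} → h x ≈[ l ] h y → x ≈[ l ] y
        h-lower⁻¹ p = Embedding.inverse-≈ κ (extend-lower⁻¹ p)
        h-continuous : ∀ x k n → ∃[ N ] ∀ y → y ~[ N ] x → h y k n ≡ h x k n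
        h-continuous x k n =
          let N , f = extend-continuous (K x) k n
          in N , λ y p → f (K y) (Embedding.lipschitz-~ κ p)
        hⱼ : Pt → ℕ → ℕ
        hⱼ x n = toℕ (h x (code j) n)
        hⱼ-continuous : ∀ x n → ∃[ N ] ∀ y → y ~[ N ] x → hⱼ y n ≡ hⱼ x n
        hⱼ-continuous x n =
          let N , f = h-continuous x (code j) n
          in N , λ y p → cong toℕ (f y p)
        module Sep′ = Separation (λ {k} {l} → ≼-antisym {k} {l}) hⱼ h hⱼ-continuous
          h-continuous h-lower h-lower⁻¹
        -- By antisymmetry one of `k` and `code j` is not below the other, and
        -- `distinct-coordinates` applies to that one.
        avoidable : ∀ {k} → k ≢ code j → Sep′.Avoidable k
        avoidable {k} k≢j {K′} κ′ eq = go em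
          where
          lower : ∀ {l x y} → x ≈[ l ] y → h (K′ x) ≈[ l ] h (K′ y)
          lower p = h-lower (Embedding.lipschitz-≈ κ′ p)
          lower⁻¹ : ∀ {l x y} → h (K′ x) ≈[ l ] h (K′ y) → x ≈[ l ] y
          lower⁻¹ p = Embedding.inverse-≈ κ′ (h-lower⁻¹ p)
          go : Dec (k ≼ code j) → ⊥
          go (no k⋠j)  = distinct-coordinates lower lower⁻¹ ≼-antisym k⋠j
                           λ z n → toℕ-injective (eq z n)
          go (yes k≼j) = distinct-coordinates lower lower⁻¹ ≼-antisym
                           (λ j≼k → k≢j (≼-antisym k≼j j≼k))
                           λ z n → sym (toℕ-injective (eq z n))
        open Sep′.Fusion (_≢ code j) avoidable
          using (limit; limit-embedding; limit-separated)
        κ′ : Embedding (K ∘ limit)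
        κ′ = ∘-embedding κ limit-embedding

theorem3p17 : (∀ {ℓ} → ExcludedMiddle ℓ) →
    V=L →
    (θ : Ξ) (X : Pred (Point θ) (lsuc 0ℓ)) → IPS θ X →
    (F : Space.setoid (D^ θ) ⟶ Space.setoid 𝒩) → Continuous (D^ θ) 𝒩 (Func.to F) →
    ∃[ Y ] IPS θ Y × Y ⊆ X ×
    ( (∀ i y → y ∈ Y → Func.to F y ∉ (Y ⇓ i))
    ⊎ (∃[ j ] (∀ y → y ∈ Y → Space._≈_ 𝒩 (Func.to F y) (ι (y [ j ])))
    × (∀ i → ¬ (Ξ._≈_ θ i j) →
    ∀ y → y ∈ Y → Func.to F y ∉ (Y ⇓ i))))
theorem3p17 em _ θ X ips F F-continuous = conclusion θ em X ips F F-continuous
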